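{- Let $a_1,a_2,b,c$ be positive integers with $a_1<a_2<b<c\leq 0.25\,a_1^2b^3$ such that $\{a_1,b,c\}$ and $\{a_2,b,c\}$ are $D(4)$-triples. Then $\{a_1,a_2,b,c\}$ is a $D(4)$-quadruple.
   Context: A set of distinct positive integers is a $D(4)$-$m$-tuple ($D(4)$-triple for $m=3$, $D(4)$-quadruple for $m=4$) if the product of any two of its distinct elements increased by $4$ is a perfect square. -}

module Defs where

open import Data.Nat using (ℕ; _+_; _*_; _<_)
open import Data.Product using (∃)
open import Data.List using (List)
open import Data.List.Relation.Unary.All using (All)
open import Data.List.Relation.Unary.Unique.Propositional using (Unique)
open import Data.List.Membership.Propositional using (_∈_)
open import Relation.Binary.PropositionalEquality using (_≡_; _≢_)

IsSquare : ℕ → Set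
IsSquare n = ∃ λ k → k * k ≡ n

record D4Tuple (xs : List ℕ) : Set where
  field
    distinct : Unique xs
    positive : All (λ x → 0 < x) xs
    pairwise : ∀ {x y} → x ∈ xs → y ∈ xs → x ≢ y → IsSquare (x * y + 4)

{-# OPTIONS --safe #-}
-- For a D(4)-triple {a, b, c} with r² = ab + 4, s² = ac + 4, t² = bc + 4, put
-- 2x = rs − at and d = b + c − a − tx.  Then x² = ad + 4 (d is the element d₋
-- extending the triple to a regular quadruple) and b + c = (a + d) + t x.
-- The bound on c gives 0 ≤ a + d < t, so a + d and x are the remainder and the
-- quotient of b + c by t, and hence do not depend on a.  Thus a₁ and a₂ are the
-- two roots of z (a + d − z) + 4 = x², which means that d₁ = a₂.
module Submission where

open import Defs
open import Data.Nat using (ℕ; suc; _+_; _*_; _<_; _≤_; s≤s; z≤n; s≤s⁻¹; >-nonZero)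
open import Data.Nat.Properties
open import Data.Nat.Divisibility using (_∣_; divides; ∣m+n∣m⇒∣n; m∣m*n; ∣m⇒∣m*n)
open import Data.Nat.Primality using (prime[2]; euclidsLemma)
open import Data.Nat.Tactic.RingSolver using (solve)
open import Data.List using (_∷_; [])
import Data.List.Relation.Unary.All as All
import Data.List.Relation.Unary.AllPairs as AllPairs
open import Data.List.Relation.Unary.Any using (here; there)
open import Data.Product using (∃; ∃₂; _×_; _,_)
open import Data.Sum using (inj₁; inj₂)
open import Relation.Binary.PropositionalEquality using (_≡_; refl; sym; trans; cong; cong₂; subst; module ≡-Reasoning)
open import Relation.Nullary using (yes; no; contradiction)

square-cancel-< : ∀ {m n} → m * m < n * n → m < n
square-cancel-< mm<nn = ≰⇒> λ n≤m → <⇒≱ mm<nn (*-mono-≤ n≤m n≤m)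

2∣square⇒2∣ : ∀ n → 2 ∣ n * n → 2 ∣ n
2∣square⇒2∣ n 2∣nn with euclidsLemma n n prime[2] 2∣nn
... | inj₁ 2∣n = 2∣n
... | inj₂ 2∣n = 2∣n

quotient-≤ : ∀ {t u u′ q q′} → u′ < t → u + t * q ≡ u′ + t * q′ → q ≤ q′
quotient-≤ {t} {u} {u′} {q} {q′} u′<t eq = ≮⇒≥ λ q′<q → <-irrefl (sym eq) (begin-strict
  u′ + t * q′   <⟨ +-monoˡ-< (t * q′) u′<t ⟩
  t + t * q′    ≡⟨ *-suc t q′ ⟨
  t * suc q′    ≤⟨ *-monoʳ-≤ t q′<q ⟩
  t * q         ≤⟨ m≤n+m (t * q) u ⟩
  u + t * q     ∎)
  where open ≤-Reasoning

divMod-unique : ∀ {t u u′ q q′} → u < t → u′ < t → u + t * q ≡ u′ + t * q′ →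
                u ≡ u′ × q ≡ q′
divMod-unique {t} {u} {u′} {q} {q′} u<t u′<t eq =
  +-cancelʳ-≡ (t * q) u u′ (trans eq (cong (λ z → u′ + t * z) (sym q≡q′))) , q≡q′
  where
  q≡q′ : q ≡ q′
  q≡q′ = ≤-antisym (quotient-≤ u′<t eq) (quotient-≤ u<t (sym eq))

-- Both pairs are the roots of one quadratic, so they agree up to order, and `a₁ < a₂` leaves only
-- the swapped order. With `a₂` written as `a₁ + k`, the sums give `d₁ ≡ d₂ + k`, and the products
-- then reduce to `k * a₁ ≡ k * d₂`.
swapped-factors : ∀ {a₁ a₂ d₁ d₂} → a₁ < a₂ → a₁ + d₁ ≡ a₂ + d₂ →
                  a₁ * d₁ ≡ a₂ * d₂ → d₁ ≡ a₂
swapped-factors {a₁} {d₁ = d₁} {d₂} a₁<a₂ sum prod with m≤n⇒∃[o]m+o≡n (<⇒≤ a₁<a₂)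
... | k , refl = trans d₁≡ (cong (_+ k) (sym a₁≡d₂))
  where
  0<k : 0 < k
  0<k = +-cancelˡ-< a₁ 0 k (subst (_< a₁ + k) (sym (+-identityʳ a₁)) a₁<a₂)
  d₁≡ : d₁ ≡ d₂ + k
  d₁≡ = +-cancelˡ-≡ a₁ d₁ (d₂ + k) (trans sum (solve (a₁ ∷ k ∷ d₂ ∷ [])))
  expanded : a₁ * d₂ + k * a₁ ≡ a₁ * d₂ + k * d₂
  expanded = begin
    a₁ * d₂ + k * a₁   ≡⟨ solve (a₁ ∷ k ∷ d₂ ∷ []) ⟩
    a₁ * (d₂ + k)      ≡⟨ cong (a₁ *_) d₁≡ ⟨
    a₁ * d₁            ≡⟨ prod ⟩
    (a₁ + k) * d₂      ≡⟨ *-distribʳ-+ d₂ a₁ k ⟩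
    a₁ * d₂ + k * d₂   ∎
    where open ≡-Reasoning
  a₁≡d₂ : a₁ ≡ d₂
  a₁≡d₂ = *-cancelˡ-≡ a₁ d₂ k {{>-nonZero 0<k}} (+-cancelˡ-≡ (a₁ * d₂) (k * a₁) (k * d₂) expanded)

module Triple {a b c r s t : ℕ} (0<a : 0 < a) (a<b : a < b) (b<c : b < c)
              (r² : r * r ≡ a * b + 4) (s² : s * s ≡ a * c + 4) (t² : t * t ≡ b * c + 4) where

  [rs]² : (r * s) * (r * s) ≡ (a * b + 4) * (a * c + 4)
  [rs]² = trans ([m*n]*[o*p]≡[m*o]*[n*p] r s r s) (cong₂ _*_ r² s²)

  [at]² : (a * t) * (a * t) ≡ a * a * (b * c + 4)
  [at]² = trans ([m*n]*[o*p]≡[m*o]*[n*p] a t a t) (cong (a * a *_) t²)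

  -- Makes rs - at a natural number. After squaring, the common term `a * a * (b * c)` drops out and
  -- `a < b` settles the rest.
  a*t≤r*s : a * t ≤ r * s
  a*t≤r*s = <⇒≤ (square-cancel-< (begin-strict
    (a * t) * (a * t)                                 ≡⟨ [at]² ⟩
    a * a * (b * c + 4)                               ≡⟨ solve (a ∷ b ∷ c ∷ []) ⟩
    -- The summand `0` lets strictness come from `0 < 16 + 4 * a * c`.
    a * a * (b * c) + 4 * a * a + 0                   <⟨ +-mono-≤-< (+-monoʳ-≤ _ (*-monoʳ-≤ (4 * a) (<⇒≤ a<b))) (s≤s z≤n) ⟩
    a * a * (b * c) + 4 * a * b + (16 + 4 * a * c)    ≡⟨ solve (a ∷ b ∷ c ∷ []) ⟩
    (a * b + 4) * (a * c + 4)                         ≡⟨ [rs]² ⟨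
    (r * s) * (r * s)                                 ∎))
    where open ≤-Reasoning

  -- Square the hypothesis and cancel `a * a * (b * c)`. For p = 2x this is four times the equation
  -- in `x-exists`.
  twice-x-equation : ∀ {p} → a * t + p ≡ r * s →
                     p * p + 2 * (a * t * p) + 4 * (a * a) ≡ 4 * (a * (b + c) + 4)
  twice-x-equation {p} eq = +-cancelˡ-≡ (a * a * (b * c)) _ _ (begin
    a * a * (b * c) + (p * p + 2 * (a * t * p) + 4 * (a * a))
      ≡⟨ regroup (a * t) ⟩
    a * a * (b * c + 4) + (p * p + 2 * (a * t * p))
      ≡⟨ cong (_+ (p * p + 2 * (a * t * p))) [at]² ⟨
    (a * t) * (a * t) + (p * p + 2 * (a * t * p))
      ≡⟨ binomial (a * t) ⟩
    (a * t + p) * (a * t + p)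
      ≡⟨ cong₂ _*_ eq eq ⟩
    (r * s) * (r * s)
      ≡⟨ [rs]² ⟩
    (a * b + 4) * (a * c + 4)
      ≡⟨ solve (a ∷ b ∷ c ∷ []) ⟩
    a * a * (b * c) + 4 * (a * (b + c) + 4) ∎)
    where
    open ≡-Reasoning
    regroup : ∀ u → a * a * (b * c) + (p * p + 2 * (u * p) + 4 * (a * a))
                  ≡ a * a * (b * c + 4) + (p * p + 2 * (u * p))
    regroup u = solve (a ∷ b ∷ c ∷ p ∷ u ∷ [])
    binomial : ∀ u → u * u + (p * p + 2 * (u * p)) ≡ (u + p) * (u + p)
    binomial u = solve (u ∷ p ∷ [])

  -- Every term of `twice-x-equation` other than `p * p` is even.
  rs-at-even : ∀ {p} → a * t + p ≡ r * s → 2 ∣ p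
  rs-at-even {p} eq = 2∣square⇒2∣ p (∣m+n∣m⇒∣n 2∣sum (m∣m*n (a * t * p + 2 * (a * a))))
    where
    rearrange : ∀ u → 2 * (u * p + 2 * (a * a)) + p * p ≡ p * p + 2 * (u * p) + 4 * (a * a)
    rearrange u = solve (u ∷ p ∷ a ∷ [])
    2∣sum : 2 ∣ 2 * (a * t * p + 2 * (a * a)) + p * p
    2∣sum = subst (2 ∣_) (sym (trans (rearrange (a * t)) (twice-x-equation eq)))
                  (∣m⇒∣m*n (a * (b + c) + 4) (divides 2 refl))

  -- This is x² = ad + 4 for d = b + c - a - tx, with the subtraction cleared because the sign of d
  -- is not yet known.
  x-exists : ∃ λ x → x * x + a * (a + t * x) ≡ a * (b + c) + 4
  x-exists = let p , eq = m≤n⇒∃[o]m+o≡n a*t≤r*s in halve (rs-at-even eq) eq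
    where
    quadruple : ∀ x → 4 * (x * x + a * (a + t * x))
                    ≡ (x * 2) * (x * 2) + 2 * (a * t * (x * 2)) + 4 * (a * a)
    quadruple x = solve (a ∷ t ∷ x ∷ [])
    halve : ∀ {p} → 2 ∣ p → a * t + p ≡ r * s →
            ∃ λ x → x * x + a * (a + t * x) ≡ a * (b + c) + 4
    halve (divides x refl) eq = x , *-cancelˡ-≡ _ _ 4 (trans (quadruple x) (twice-x-equation eq))

  -- Shows d ≥ 0. A negative d would force x² < 4, so x ≤ 1 and b + c < a + t. With a < b this gives
  -- t ≥ c + 2, so t² is too large to equal bc + 4.
  a+tx≤b+c : ∀ {x} → x * x + a * (a + t * x) ≡ a * (b + c) + 4 → a + t * x ≤ b + c
  a+tx≤b+c {x} eq = ≮⇒≥ λ b+c<a+tx → <⇒≱ (t²-large b+c<a+tx) (≤-reflexive t²)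
    where
    open ≤-Reasoning
    x<2 : b + c < a + t * x → x < 2
    x<2 lt = square-cancel-< (+-cancelʳ-< (a * (b + c)) (x * x) 4 (begin-strict
      x * x + a * (b + c)       <⟨ +-monoʳ-< (x * x) (*-monoʳ-< a {{>-nonZero 0<a}} lt) ⟩
      x * x + a * (a + t * x)   ≡⟨ eq ⟩
      a * (b + c) + 4           ≡⟨ +-comm (a * (b + c)) 4 ⟩
      4 + a * (b + c)           ∎))
    c<t : b + c < a + t * x → suc c < t
    c<t lt = +-cancelˡ-< a _ _ (begin-strict
      a + suc c    ≡⟨ +-suc a c ⟩
      suc a + c    ≤⟨ +-monoˡ-≤ c a<b ⟩
      b + c        <⟨ lt ⟩
      a + t * x    ≤⟨ +-monoʳ-≤ a (*-monoʳ-≤ t (s≤s⁻¹ (x<2 lt))) ⟩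
      a + t * 1    ≡⟨ cong (a +_) (*-identityʳ t) ⟩
      a + t        ∎)
    t²-large : b + c < a + t * x → b * c + 4 < t * t
    t²-large lt = begin-strict
      b * c + 4                     ≤⟨ +-monoˡ-≤ 4 (*-monoˡ-≤ c (<⇒≤ b<c)) ⟩
      c * c + 4                     <⟨ m<m+n (c * c + 4) (≤-trans (≤-trans (s≤s z≤n) b<c) (m≤m+n c _)) ⟩
      c * c + 4 + 4 * c             ≡⟨ solve (c ∷ []) ⟩
      (2 + c) * (2 + c)             ≤⟨ *-mono-≤ (c<t lt) (c<t lt) ⟩
      t * t                         ∎

  regular-extension : ∃₂ λ x d → (a + d) + t * x ≡ b + c × x * x ≡ a * d + 4
  regular-extension =
    let x , eq = x-exists
        -- Here `d` can be `0`, as for the triple 1, 5, 12.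
        d , sum = m≤n⇒∃[o]m+o≡n (a+tx≤b+c eq)
    in x , d , trans (reorder d (t * x)) sum , x-square eq sum
    where
    open ≡-Reasoning
    reorder : ∀ d u → a + d + u ≡ a + u + d
    reorder d u = solve (a ∷ d ∷ u ∷ [])
    expand : ∀ d u → a * (u + d) + 4 ≡ a * d + 4 + a * u
    expand d u = solve (a ∷ d ∷ u ∷ [])
    x-square : ∀ {x d} → x * x + a * (a + t * x) ≡ a * (b + c) + 4 →
               a + t * x + d ≡ b + c → x * x ≡ a * d + 4
    x-square {x} {d} eq sum = +-cancelʳ-≡ (a * (a + t * x)) _ _ (begin
      x * x + a * (a + t * x)        ≡⟨ eq ⟩
      a * (b + c) + 4                ≡⟨ cong (λ z → a * z + 4) sum ⟨
      a * (a + t * x + d) + 4        ≡⟨ expand d (a + t * x) ⟩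
      a * d + 4 + a * (a + t * x)    ∎)

  b<t : b < t
  b<t = square-cancel-< (begin-strict
    b * b       ≤⟨ *-monoʳ-≤ b (<⇒≤ b<c) ⟩
    b * c       <⟨ m<m+n (b * c) (s≤s z≤n) ⟩
    b * c + 4   ≡⟨ t² ⟨
    t * t       ∎)
    where open ≤-Reasoning

  module _ (4c≤a²b³ : 4 * c ≤ (a * a) * (b * b * b)) {x d : ℕ}
           (sum : (a + d) + t * x ≡ b + c) (x² : x * x ≡ a * d + 4) where
    open ≤-Reasoning

    -- When a + d exceeds b, the equation `sum` leaves tx < c, and bc · ad is at most t²x² < c².
    abd<c : b < a + d → a * b * d < c
    abd<c b<a+d = *-cancelʳ-< c _ _ (begin-strict
      a * b * d * c                  ≡⟨ solve (a ∷ b ∷ c ∷ d ∷ []) ⟩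
      b * c * (a * d)                ≤⟨ *-mono-≤ (m≤m+n (b * c) 4) (m≤m+n (a * d) 4) ⟩
      (b * c + 4) * (a * d + 4)      ≡⟨ cong₂ _*_ t² x² ⟨
      (t * t) * (x * x)              ≡⟨ solve (t ∷ x ∷ []) ⟩
      (t * x) * (t * x)              <⟨ *-mono-< tx<c tx<c ⟩
      c * c                          ∎)
      where
      tx<c : t * x < c
      tx<c = +-cancelˡ-< b _ _ (begin-strict
        b + t * x         <⟨ +-monoˡ-< (t * x) b<a+d ⟩
        a + d + t * x     ≡⟨ sum ⟩
        b + c             ∎)

    -- The upper bound on `c` does its work here: 4(abd)² ≤ 4c² ≤ a²b³c, and dividing by a²b² leaves
    -- 4d² ≤ bc < t².
    2d<t : b < a + d → 2 * d < t
    2d<t b<a+d = square-cancel-< (begin-strict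
      (2 * d) * (2 * d)   ≤⟨ *-cancelˡ-≤ (a * b * (a * b)) {{>-nonZero (*-mono-< 0<ab 0<ab)}} bound ⟩
      b * c               <⟨ m<m+n (b * c) (s≤s z≤n) ⟩
      b * c + 4           ≡⟨ t² ⟨
      t * t               ∎)
      where
      0<ab : 0 < a * b
      0<ab = *-mono-< 0<a (<-trans 0<a a<b)
      bound : a * b * (a * b) * ((2 * d) * (2 * d)) ≤ a * b * (a * b) * (b * c)
      bound = begin
        a * b * (a * b) * ((2 * d) * (2 * d))   ≡⟨ solve (a ∷ b ∷ d ∷ []) ⟩
        4 * ((a * b * d) * (a * b * d))         ≤⟨ *-monoʳ-≤ 4 (*-mono-≤ (<⇒≤ (abd<c b<a+d)) (<⇒≤ (abd<c b<a+d))) ⟩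
        4 * (c * c)                             ≡⟨ *-assoc 4 c c ⟨
        4 * c * c                               ≤⟨ *-monoˡ-≤ c 4c≤a²b³ ⟩
        (a * a) * (b * b * b) * c               ≡⟨ solve (a ∷ b ∷ c ∷ []) ⟩
        a * b * (a * b) * (b * c)               ∎

    2a<t : b < a + d → 2 * a < t
    2a<t b<a+d = square-cancel-< (begin-strict
      (2 * a) * (2 * a)   ≡⟨ solve (a ∷ []) ⟩
      -- One factor 2 is absorbed by `b`, the other by `d`; the latter is possible since a < b < a +
      -- d leaves a gap of at least 2.
      2 * (a * a * 2)     ≤⟨ *-mono-≤ 2≤b (*-mono-≤ (*-monoʳ-≤ a (<⇒≤ a<b)) 2≤d) ⟩
      b * (a * b * d)     ≤⟨ *-monoʳ-≤ b (<⇒≤ (abd<c b<a+d)) ⟩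
      b * c               <⟨ m<m+n (b * c) (s≤s z≤n) ⟩
      b * c + 4           ≡⟨ t² ⟨
      t * t               ∎)
      where
      2≤b : 2 ≤ b
      2≤b = ≤-trans (s≤s 0<a) a<b
      2≤d : 2 ≤ d
      2≤d = +-cancelˡ-< a 1 d (begin-strict
        a + 1    ≡⟨ +-comm a 1 ⟩
        suc a    ≤⟨ a<b ⟩
        b        <⟨ b<a+d ⟩
        a + d    ∎)

    a+d<t : a + d < t
    -- Either a + d is at most b, which is already below t, or both halves `2 * a` and `2 * d` are
    -- below t and their average is too.
    a+d<t with a + d ≤? b
    ... | yes a+d≤b = ≤-<-trans a+d≤b b<t
    ... | no a+d≰b = *-cancelˡ-< 2 (a + d) t (begin-strict
      2 * (a + d)       ≡⟨ *-distribˡ-+ 2 a d ⟩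
      2 * a + 2 * d     <⟨ +-mono-< (2a<t (≰⇒> a+d≰b)) (2d<t (≰⇒> a+d≰b)) ⟩
      t + t             ≡⟨ solve (t ∷ []) ⟩
      2 * t             ∎)

smaller-pair-square : ∀ {a₁ a₂ b c} → 0 < a₁ → a₁ < a₂ → a₂ < b → b < c →
  4 * c ≤ (a₁ * a₁) * (b * b * b) →
  IsSquare (a₁ * b + 4) → IsSquare (a₁ * c + 4) →
  IsSquare (a₂ * b + 4) → IsSquare (a₂ * c + 4) →
  IsSquare (b * c + 4) → IsSquare (a₁ * a₂ + 4)
smaller-pair-square {a₁} {a₂} {b} 0<a₁ a₁<a₂ a₂<b b<c 4c≤
                    (r₁ , r₁²) (s₁ , s₁²) (r₂ , r₂²) (s₂ , s₂²) (t , t²) =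
  let module T₁ = Triple {r = r₁} {s₁} {t} 0<a₁ (<-trans a₁<a₂ a₂<b) b<c r₁² s₁² t²
      module T₂ = Triple {r = r₂} {s₂} {t} (<-trans 0<a₁ a₁<a₂) a₂<b b<c r₂² s₂² t²
      -- The bound weakens as a grows, so it passes from `a₁` to `a₂`.
      4c≤′ = ≤-trans 4c≤ (*-monoˡ-≤ (b * b * b) (*-mono-≤ (<⇒≤ a₁<a₂) (<⇒≤ a₁<a₂)))
      x₁ , d₁ , sum₁ , x₁² = T₁.regular-extension
      x₂ , d₂ , sum₂ , x₂² = T₂.regular-extension
      -- Both triples share the root `t` of bc + 4, so these are two divisions of the same `b + c`
      -- by the same `t`.
      a+d≡ , x≡ = divMod-unique (T₁.a+d<t 4c≤ sum₁ x₁²) (T₂.a+d<t 4c≤′ sum₂ x₂²)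
                                (trans sum₁ (sym sum₂))
      prod≡ = +-cancelʳ-≡ 4 _ _ (trans (sym x₁²) (trans (cong₂ _*_ x≡ x≡) x₂²))
  -- Since `d₁` is `a₂`, the root wanted for `a₁ * a₂ + 4` is `x₁`.
  in x₁ , trans x₁² (cong (λ z → a₁ * z + 4) (swapped-factors a₁<a₂ a+d≡ prod≡))

theorem4p2 : (a₁ a₂ b c : ℕ) → 0 < a₁ → a₁ < a₂ → a₂ < b → b < c →
    4 * c ≤ (a₁ * a₁) * (b * b * b) →
    D4Tuple (a₁ ∷ b ∷ c ∷ []) → D4Tuple (a₂ ∷ b ∷ c ∷ []) →
    D4Tuple (a₁ ∷ a₂ ∷ b ∷ c ∷ [])
theorem4p2 a₁ a₂ b c 0<a₁ a₁<a₂ a₂<b b<c 4c≤ T₁ T₂ = record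
  { distinct = (<⇒≢ a₁<a₂ All.∷ AllPairs.head T₁.distinct) AllPairs.∷ T₂.distinct
  ; positive = 0<a₁ All.∷ T₂.positive
  -- Only the pair `a₁`, `a₂` lies in neither triple. Positions in the first triple have one `there`
  -- fewer because `a₂` is missing from it.
  ; pairwise = λ where
      (here refl) (here refl) a₁≢a₁ → contradiction refl a₁≢a₁
      (here refl) (there (here refl)) _ → a₁a₂
      (here refl) (there (there q)) → T₁.pairwise (here refl) (there q)
      (there (here refl)) (here refl) _ → subst (λ z → IsSquare (z + 4)) (*-comm a₁ a₂) a₁a₂
      (there (there p)) (here refl) → T₁.pairwise (there p) (here refl)
      (there p) (there q) → T₂.pairwise p q
  }
  where
  module T₁ = D4Tuple T₁
  module T₂ = D4Tuple T₂
  a₁<b = <-trans a₁<a₂ a₂<b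
  a₁a₂ : IsSquare (a₁ * a₂ + 4)
  a₁a₂ = smaller-pair-square 0<a₁ a₁<a₂ a₂<b b<c 4c≤
    (T₁.pairwise (here refl) (there (here refl)) (<⇒≢ a₁<b))
    (T₁.pairwise (here refl) (there (there (here refl))) (<⇒≢ (<-trans a₁<b b<c)))
    (T₂.pairwise (here refl) (there (here refl)) (<⇒≢ a₂<b))
    (T₂.pairwise (here refl) (there (there (here refl))) (<⇒≢ (<-trans a₂<b b<c)))
    (T₁.pairwise (there (here refl)) (there (there (here refl))) (<⇒≢ b<c))
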